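{- Let $m$ be a nonnegative integer, and let $C$ and $D$ be sets of nonnegative integers such that $C \cup D = [0, m]$, $C \cap D = \emptyset$ and $0 \in C$. Then $R_{C}(n) = R_{D}(n)$ for every positive integer $n$ if and only if there exists a natural number $l$ such that $C = A_{l}$ and $D = B_{l}$.
   Context: Natural numbers are nonnegative integers, $\mathbb{N} = \{0,1,2,\dots\}$, and $[a,b]$ denotes the set of integers $x$ with $a \le x \le b$. For a set $S$ of nonnegative integers, $R_S(n)$ denotes the number of solutions of $s + s' = n$ with $s, s' \in S$ and $s < s'$. $A$ is the set of those nonnegative integers whose binary representation contains an even number of digits $1$ (so $0 \in A$), and $B = \mathbb{N} \setminus A$. For a natural number $l$, $A_l = A \cap [0, 2^l - 1]$ and $B_l = B \cap [0, 2^l - 1]$. -}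

module Defs where

open import Data.Digit using (toDigits)
open import Data.Fin.Base using (suc; zero)
import Data.Fin.Properties as Fin
open import Data.List.Base using (length; filter; upTo; cartesianProduct)
open import Data.Nat.Base using (ℕ; suc; _+_; _∸_; _^_; _≤_; _<_)
open import Data.Nat.Divisibility using (_∣_)
open import Data.Nat.Properties using (_≟_; _≤?_; _<?_)
open import Data.Product.Base using (_×_; _,_; proj₁; proj₂)
open import Data.Sum.Base using (inj₁; inj₂)
open import Level using (Level; 0ℓ)
open import Relation.Binary.PropositionalEquality using (_≡_)
open import Relation.Nullary.Decidable using (yes; no; _×-dec_)
open import Relation.Unary
  using (Pred; Decidable; _∈_; _∩_; _∪_; ∁; ∅; _≐_)

private
  variable
    c d ℓ : Level

[_,_] : ℕ → ℕ → Pred ℕ 0ℓ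
[ a , b ] x = a ≤ x × x ≤ b

[_,_]? : ∀ a b → Decidable [ a , b ]
[ a , b ]? x = (a ≤? x) ×-dec (x ≤? b)

Solution : Pred ℕ ℓ → ℕ → Pred (ℕ × ℕ) ℓ
Solution S n (s , s′) = s ∈ S × s′ ∈ S × s < s′ × s + s′ ≡ n

solution? : {S : Pred ℕ ℓ} → Decidable S → ∀ n → Decidable (Solution S n)
solution? S? n (s , s′) =
  S? s ×-dec S? s′ ×-dec (s <? s′) ×-dec (s + s′ ≟ n)

-- Both components of a solution are at most n, so the search over
-- {0,…,n}² is exhaustive.
R : {S : Pred ℕ ℓ} → Decidable S → ℕ → ℕ
R S? n = length (filter (solution? S? n)
                        (cartesianProduct (upTo (suc n)) (upTo (suc n))))

-- Counting needs decidable membership; for the two parts of a partition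
-- of a decidable set it comes for free.
module _ {P : Pred ℕ ℓ} (P? : Decidable P) (C : Pred ℕ c) (D : Pred ℕ d)
         (cover : C ∪ D ≐ P) (disjoint : C ∩ D ≐ ∅) where

  partˡ? : Decidable C
  partˡ? x with P? x
  ... | no x∉P = no λ x∈C → x∉P (proj₁ cover (inj₁ x∈C))
  ... | yes x∈P with proj₂ cover x∈P
  ...   | inj₁ x∈C = yes x∈C
  ...   | inj₂ x∈D = no λ x∈C → proj₁ disjoint (x∈C , x∈D)

  partʳ? : Decidable D
  partʳ? x with P? x
  ... | no x∉P = no λ x∈D → x∉P (proj₁ cover (inj₂ x∈D))
  ... | yes x∈P with proj₂ cover x∈P
  ...   | inj₁ x∈C = no λ x∈D → proj₁ disjoint (x∈C , x∈D)
  ...   | inj₂ x∈D = yes x∈D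

binaryOnes : ℕ → ℕ
binaryOnes n = length (filter (Fin._≟ suc zero) (proj₁ (toDigits 2 n)))

A : Pred ℕ 0ℓ
A n = 2 ∣ binaryOnes n

B : Pred ℕ 0ℓ
B = ∁ A

Aₗ : ℕ → Pred ℕ 0ℓ
Aₗ l = A ∩ [ 0 , 2 ^ l ∸ 1 ]

Bₗ : ℕ → Pred ℕ 0ℓ
Bₗ l = B ∩ [ 0 , 2 ^ l ∸ 1 ]

{-# OPTIONS --safe #-}

-- Put p = 1_C − 1_D. For i, j ∈ [0,m], 1_C(i) 1_C(j) − 1_D(i) 1_D(j) equals
-- (p(i) + p(j)) / 2, so 2 (R_C − R_D)(n) is the sum of p(i) over the
-- i ∈ [0,m] with n − i ∈ [0,m] and 2i ≠ n. For n ≤ m this is a prefix sum of p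
-- minus a diagonal term; its vanishing says p(2j) = p(j) and p(2j+1) = −p(j), so
-- p is the Thue–Morse sequence t on [0,m]. The reflection i ↦ m − i exchanges n
-- with 2m − n, so p(m − i) satisfies the same recursion and t(i) t(j) = t(m)
-- whenever i + j = m. That symmetry fails for even m > 0 and passes between k
-- and 2k + 1, hence it holds exactly for m = 2^l − 1; conversely it carries the
-- vanishing for n ≤ m over to m < n ≤ 2m.

module Submission where

open import Defs
import Algebra.Properties.AbelianGroup as AbelianGroup
open import Data.Bool.Base using (if_then_else_; true; false)
open import Data.Digit using (Expansion; fromDigits; toDigits)
open import Data.Fin.Base using (suc; zero)
import Data.Fin.Properties as Fin
open import Data.Integer.Base using (ℤ; +_; 0ℤ; 1ℤ; -1ℤ; -_; _+_; _*_; _-_; _^_)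
import Data.Integer.Properties as ℤ
open import Data.Integer.Tactic.RingSolver using (solve-∀)
open import Data.List.Base using (List; []; _∷_; _++_; length; filter; map; upTo; cartesianProduct)
import Data.List.Properties as List
open import Data.Nat.Base as ℕ using (ℕ; zero; suc; _∸_; _≤_; _<_; z≤n; s≤s)
open import Data.Nat.Divisibility using (_∣_; _∣0; ∣1⇒≡1; ∣-refl; ∣m∣n⇒∣m+n; ∣m+n∣m⇒∣n)
open import Data.Nat.Induction using (<-rec)
import Data.Nat.Properties as ℕ
open import Data.Nat.Tactic.RingSolver using () renaming (solve-∀ to solveℕ-∀)
open import Data.Product.Base using (_×_; _,_; ∃-syntax; proj₁; proj₂)
open import Data.Sum.Base using (_⊎_; inj₁; inj₂; fromInj₁; fromInj₂)
open import Function.Base using (_∘_)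
open import Function.Bundles using (_⇔_; mk⇔)
open import Level using (Level; 0ℓ)
open import Relation.Binary.Definitions using (tri<; tri≈; tri>)
open import Relation.Binary.PropositionalEquality
  using (_≡_; _≢_; refl; sym; trans; cong; cong₂; subst; module ≡-Reasoning)
open import Relation.Nullary using (¬_; Dec; yes; no; does; ¬?; contradiction; _×-dec_)
open import Relation.Nullary.Decidable using (does-⇔; dec-true; dec-false)
open import Relation.Unary using (Pred; Decidable; _∈_; _∩_; _∪_; ∅; _≐_)

open AbelianGroup ℤ.+-0-abelianGroup using (∙-cancelˡ; ∙-cancelʳ)
open ≡-Reasoning

private
  variable
    a b ℓ : Level
    P : Set a
    Q : Set b
    f g : ℕ → ℤ

-- Finite sums of integers

∑ : ℕ → (ℕ → ℤ) → ℤ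
∑ zero    f = 0ℤ
∑ (suc n) f = ∑ n f + f n

∑-cong : ∀ n → (∀ i → i < n → f i ≡ g i) → ∑ n f ≡ ∑ n g
∑-cong zero    eq = refl
∑-cong (suc n) eq =
  cong₂ _+_ (∑-cong n λ i i<n → eq i (ℕ.m<n⇒m<1+n i<n)) (eq n (ℕ.n<1+n n))

∑-zero : ∀ n → (∀ i → i < n → f i ≡ 0ℤ) → ∑ n f ≡ 0ℤ
∑-zero zero    eq = refl
∑-zero (suc n) eq =
  cong₂ _+_ (∑-zero n λ i i<n → eq i (ℕ.m<n⇒m<1+n i<n)) (eq n (ℕ.n<1+n n))

∑-distrib-+ : ∀ n (f g : ℕ → ℤ) → ∑ n (λ i → f i + g i) ≡ ∑ n f + ∑ n g
∑-distrib-+ zero    f g = refl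
∑-distrib-+ (suc n) f g = begin
  ∑ n (λ i → f i + g i) + (f n + g n)  ≡⟨ cong (_+ (f n + g n)) (∑-distrib-+ n f g) ⟩
  (∑ n f + ∑ n g) + (f n + g n)        ≡⟨ interchange (∑ n f) (∑ n g) (f n) (g n) ⟩
  (∑ n f + f n) + (∑ n g + g n)        ∎
  where
  interchange : ∀ w x y z → (w + x) + (y + z) ≡ (w + y) + (x + z)
  interchange = solve-∀

*-distribˡ-∑ : ∀ n x (f : ℕ → ℤ) → ∑ n (λ i → x * f i) ≡ x * ∑ n f
*-distribˡ-∑ zero    x f = sym (ℤ.*-zeroʳ x)
*-distribˡ-∑ (suc n) x f =
  trans (cong (_+ x * f n) (*-distribˡ-∑ n x f)) (sym (ℤ.*-distribˡ-+ x (∑ n f) (f n)))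

∑-head : ∀ n (f : ℕ → ℤ) → ∑ (suc n) f ≡ f 0 + ∑ n (f ∘ suc)
∑-head zero    f = ℤ.+-comm 0ℤ (f 0)
∑-head (suc n) f =
  trans (cong (_+ f (suc n)) (∑-head n f)) (ℤ.+-assoc (f 0) (∑ n (f ∘ suc)) (f (suc n)))

∑-reverse : ∀ n (f : ℕ → ℤ) → ∑ (suc n) (λ i → f (n ∸ i)) ≡ ∑ (suc n) f
∑-reverse zero    f = refl
∑-reverse (suc n) f = begin
  ∑ (2 ℕ.+ n) (λ i → f (suc n ∸ i))            ≡⟨ ∑-head (suc n) (λ i → f (suc n ∸ i)) ⟩
  f (suc n) + ∑ (suc n) (λ i → f (n ∸ i))      ≡⟨ cong (λ x → f (suc n) + x) (∑-reverse n f) ⟩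
  f (suc n) + ∑ (suc n) f                      ≡⟨ ℤ.+-comm (f (suc n)) _ ⟩
  ∑ (2 ℕ.+ n) f                                ∎

∑-extend : ∀ k n → (∀ i → n ≤ i → f i ≡ 0ℤ) → ∑ (k ℕ.+ n) f ≡ ∑ n f
∑-extend         zero    n eq = refl
∑-extend {f = f} (suc k) n eq =
  trans (cong₂ _+_ (∑-extend k n eq) (eq (k ℕ.+ n) (ℕ.m≤n+m n k))) (ℤ.+-identityʳ (∑ n f))

∑-range : ∀ m n → (∀ i → m ≤ i → f i ≡ 0ℤ) → (∀ i → n ≤ i → f i ≡ 0ℤ) → ∑ m f ≡ ∑ n f
∑-range {f = f} m n zeroₘ zeroₙ = begin
  ∑ m f          ≡⟨ ∑-extend n m zeroₘ ⟨
  ∑ (n ℕ.+ m) f  ≡⟨ cong (λ k → ∑ k f) (ℕ.+-comm n m) ⟩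
  ∑ (m ℕ.+ n) f  ≡⟨ ∑-extend m n zeroₙ ⟩
  ∑ n f          ∎

∑-single : ∀ n k → k < n → (∀ i → i ≢ k → f i ≡ 0ℤ) → ∑ n f ≡ f k
∑-single {f = f} (suc n) k k<1+n eq with k ℕ.≟ n
... | yes refl = trans (cong (_+ f n) (∑-zero n λ i i<n → eq i (ℕ.<⇒≢ i<n))) (ℤ.+-identityˡ (f n))
... | no  k≢n  = trans (cong₂ _+_ (∑-single n k (ℕ.≤∧≢⇒< (ℕ.s≤s⁻¹ k<1+n) k≢n) eq) (eq n (k≢n ∘ sym)))
                       (ℤ.+-identityʳ (f k))

-- Indicators, and representation counts as sums

𝟙 : Dec P → ℤ
𝟙 P? = if does P? then 1ℤ else 0ℤ

𝟙-yes : (P? : Dec P) → P → 𝟙 P? ≡ 1ℤ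
𝟙-yes P? p = cong (if_then 1ℤ else 0ℤ) (dec-true P? p)

𝟙-no : (P? : Dec P) → ¬ P → 𝟙 P? ≡ 0ℤ
𝟙-no P? ¬p = cong (if_then 1ℤ else 0ℤ) (dec-false P? ¬p)

𝟙-⇔ : (P? : Dec P) (Q? : Dec Q) → (P → Q) → (Q → P) → 𝟙 P? ≡ 𝟙 Q?
𝟙-⇔ P? Q? to from = cong (if_then 1ℤ else 0ℤ) (does-⇔ (mk⇔ to from) P? Q?)

𝟙-× : (P? : Dec P) (Q? : Dec Q) → 𝟙 (P? ×-dec Q?) ≡ 𝟙 P? * 𝟙 Q?
𝟙-× P? Q? with does P? | does Q?
... | true  | true  = refl
... | true  | false = refl
... | false | true  = refl
... | false | false = refl

-- `∑` grows at its last term, so the induction splits `upTo` at its last element instead of its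
-- head.
length-filter-upTo : {S : Pred ℕ ℓ} (S? : Decidable S) → ∀ n →
                     + length (filter S? (upTo n)) ≡ ∑ n (λ i → 𝟙 (S? i))
length-filter-upTo S? zero    = refl
length-filter-upTo S? (suc n) = begin
  + length (filter S? (upTo (suc n)))
    ≡⟨ cong (λ xs → + length (filter S? xs)) (List.upTo-∷ʳ n) ⟨
  + length (filter S? (upTo n ++ n ∷ []))
    ≡⟨ cong (+_ ∘ length) (List.filter-++ S? (upTo n) (n ∷ [])) ⟩
  + length (filter S? (upTo n) ++ filter S? (n ∷ []))
    ≡⟨ cong +_ (List.length-++ (filter S? (upTo n))) ⟩
  + (length (filter S? (upTo n)) ℕ.+ length (filter S? (n ∷ [])))
    ≡⟨ ℤ.pos-+ (length (filter S? (upTo n))) _ ⟩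
  + length (filter S? (upTo n)) + + length (filter S? (n ∷ []))
    ≡⟨ cong₂ _+_ (length-filter-upTo S? n) last ⟩
  ∑ n (λ i → 𝟙 (S? i)) + 𝟙 (S? n)
    ∎
  where
  last : + length (filter S? (n ∷ [])) ≡ 𝟙 (S? n)
  last with does (S? n)
  ... | true  = refl
  ... | false = refl

length-filter-map : ∀ {A : Set a} {B : Set b} {S : Pred B ℓ} (S? : Decidable S) (h : A → B) xs →
                    length (filter S? (map h xs)) ≡ length (filter (S? ∘ h) xs)
length-filter-map S? h []       = refl
length-filter-map S? h (x ∷ xs) with does (S? (h x))
... | true  = cong suc (length-filter-map S? h xs)
... | false = length-filter-map S? h xs

length-filter-cartesianProduct :
  {S : Pred (ℕ × ℕ) ℓ} (S? : Decidable S) → ∀ n ys →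
  + length (filter S? (cartesianProduct (upTo n) ys)) ≡
  ∑ n (λ i → + length (filter (λ y → S? (i , y)) ys))
length-filter-cartesianProduct S? zero    ys = refl
length-filter-cartesianProduct S? (suc n) ys = begin
  count (cartesianProduct (upTo (suc n)) ys)
    ≡⟨ cong (λ xs → count (cartesianProduct xs ys)) (List.upTo-∷ʳ n) ⟨
  count (cartesianProduct (upTo n ++ n ∷ []) ys)
    ≡⟨ cong count (List.cartesianProductWith-distribʳ-++ _,_ (upTo n) (n ∷ []) ys) ⟩
  count (cartesianProduct (upTo n) ys ++ map (n ,_) ys ++ [])
    ≡⟨ cong (λ zs → count (cartesianProduct (upTo n) ys ++ zs)) (List.++-identityʳ (map (n ,_) ys)) ⟩
  count (cartesianProduct (upTo n) ys ++ map (n ,_) ys)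
    ≡⟨ cong (+_ ∘ length) (List.filter-++ S? (cartesianProduct (upTo n) ys) (map (n ,_) ys)) ⟩
  + length (filter S? (cartesianProduct (upTo n) ys) ++ filter S? (map (n ,_) ys))
    ≡⟨ cong +_ (List.length-++ (filter S? (cartesianProduct (upTo n) ys))) ⟩
  + (length (filter S? (cartesianProduct (upTo n) ys)) ℕ.+ length (filter S? (map (n ,_) ys)))
    ≡⟨ ℤ.pos-+ (length (filter S? (cartesianProduct (upTo n) ys))) _ ⟩
  count (cartesianProduct (upTo n) ys) + count (map (n ,_) ys)
    ≡⟨ cong₂ _+_ (length-filter-cartesianProduct S? n ys) (cong +_ (length-filter-map S? (n ,_) ys)) ⟩
  ∑ (suc n) (λ i → + length (filter (λ y → S? (i , y)) ys))
    ∎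
  where
  count : List (ℕ × ℕ) → ℤ
  count zs = + length (filter S? zs)

-- For fixed i only j = n - i can solve i + j = n, so the inner count collapses to a single
-- indicator. Since i ≤ n on the range of summation, the truncated difference is exact.
R-as-∑ : {S : Pred ℕ ℓ} (S? : Decidable S) → ∀ n →
         + R S? n ≡ ∑ (suc n) (λ i → 𝟙 (S? i) * 𝟙 (S? (n ∸ i)) * 𝟙 (i ℕ.<? n ∸ i))
R-as-∑ S? n = trans
  (length-filter-cartesianProduct (solution? S? n) (suc n) (upTo (suc n)))
  (∑-cong (suc n) λ i i<1+n → begin
    + length (filter (λ j → solution? S? n (i , j)) (upTo (suc n)))
      ≡⟨ length-filter-upTo (λ j → solution? S? n (i , j)) (suc n) ⟩
    ∑ (suc n) (λ j → 𝟙 (solution? S? n (i , j)))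
      ≡⟨ ∑-single (suc n) (n ∸ i) (s≤s (ℕ.m∸n≤m n i)) (λ j j≢n∸i →
           𝟙-no (solution? S? n (i , j)) λ (_ , _ , _ , i+j≡n) →
             j≢n∸i (trans (sym (ℕ.m+n∸m≡n i j)) (cong (_∸ i) i+j≡n))) ⟩
    𝟙 (solution? S? n (i , n ∸ i))
      ≡⟨ 𝟙-⇔ (solution? S? n (i , n ∸ i)) ((S? i ×-dec S? (n ∸ i)) ×-dec (i ℕ.<? n ∸ i))
           (λ (si , sj , i<j , _) → (si , sj) , i<j)
           (λ ((si , sj) , i<j) → si , sj , i<j , ℕ.m+[n∸m]≡n (ℕ.s≤s⁻¹ i<1+n)) ⟩
    𝟙 ((S? i ×-dec S? (n ∸ i)) ×-dec (i ℕ.<? n ∸ i))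
      ≡⟨ trans (𝟙-× (S? i ×-dec S? (n ∸ i)) (i ℕ.<? n ∸ i)) (cong (_* 𝟙 (i ℕ.<? n ∸ i)) (𝟙-× (S? i) (S? (n ∸ i)))) ⟩
    𝟙 (S? i) * 𝟙 (S? (n ∸ i)) * 𝟙 (i ℕ.<? n ∸ i)
      ∎)

-- Parity and induction on binary digits

double-injective : ∀ {i j} → i ℕ.+ i ≡ j ℕ.+ j → i ≡ j
double-injective {i} {j} eq =
  trans (ℕ.n≡⌊n+n/2⌋ i) (trans (cong ℕ.⌊_/2⌋ eq) (sym (ℕ.n≡⌊n+n/2⌋ j)))

double≢suc-double : ∀ i j → i ℕ.+ i ≢ suc (j ℕ.+ j)
double≢suc-double i j eq = ℕ.even≢odd i j (begin
  2 ℕ.* i        ≡⟨ cong (i ℕ.+_) (ℕ.+-identityʳ i) ⟩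
  i ℕ.+ i        ≡⟨ eq ⟩
  suc (j ℕ.+ j)  ≡⟨ cong (λ k → suc (j ℕ.+ k)) (ℕ.+-identityʳ j) ⟨
  suc (2 ℕ.* j)  ∎)

n≤n+n : ∀ n → n ≤ n ℕ.+ n
n≤n+n n = ℕ.m≤m+n n n

halve : ∀ n → ∃[ j ] (n ≡ j ℕ.+ j ⊎ n ≡ suc (j ℕ.+ j))
halve zero = 0 , inj₁ refl
halve (suc n) with halve n
... | j , inj₁ n≡2j   = j , inj₂ (cong suc n≡2j)
... | j , inj₂ n≡1+2j = suc j , inj₁ (cong suc (trans n≡1+2j (sym (ℕ.+-suc j j))))

-- The even case starts at `suc j`: zero is its own double, so only positive numbers become smaller
-- when halved.
binary-induction : (P : Pred ℕ ℓ) → P 0 →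
                   (∀ j → P (suc j) → P (suc j ℕ.+ suc j)) →
                   (∀ j → P j → P (suc (j ℕ.+ j))) → ∀ n → P n
binary-induction P P0 even odd = <-rec P step
  where
  step : ∀ n → (∀ {k} → k < n → P k) → P n
  step n rec with halve n
  ... | zero  , inj₁ refl = P0
  ... | suc j , inj₁ refl = even j (rec (ℕ.m<m+n (suc j) (s≤s z≤n)))
  ... | j     , inj₂ refl = odd j (rec (s≤s (n≤n+n j)))

-- Binary digits and the Thue-Morse sequence

ones : Expansion 2 → ℕ
ones ds = length (filter (Fin._≟ suc zero) ds)

ones-zero : ∀ ds → fromDigits ds ≡ 0 → ones ds ≡ 0
ones-zero []          eq = refl
ones-zero (zero ∷ ds) eq = ones-zero ds (ℕ.m*n≡0⇒m≡0 (fromDigits ds) 2 eq)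

*2≢suc-*2 : ∀ i j → i ℕ.* 2 ≢ suc (j ℕ.* 2)
*2≢suc-*2 i j eq = ℕ.even≢odd i j (begin
  2 ℕ.* i        ≡⟨ ℕ.*-comm 2 i ⟩
  i ℕ.* 2        ≡⟨ eq ⟩
  suc (j ℕ.* 2)  ≡⟨ cong suc (ℕ.*-comm j 2) ⟩
  suc (2 ℕ.* j)  ∎)

-- Digit lists begin with the least significant digit and may end in zeros, so equal values do not
-- force equal lists. Parity fixes the first digit and halving handles the rest; once one list ends,
-- the other holds only zeros.
ones-unique : ∀ ds es → fromDigits ds ≡ fromDigits es → ones ds ≡ ones es
ones-unique []              es              eq = sym (ones-zero es (sym eq))
ones-unique (d ∷ ds)        []              eq = ones-zero (d ∷ ds) eq
ones-unique (zero ∷ ds)     (zero ∷ es)     eq = ones-unique ds es (ℕ.*-cancelʳ-≡ _ _ 2 eq)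
ones-unique (zero ∷ ds)     (suc zero ∷ es) eq = contradiction eq (*2≢suc-*2 (fromDigits ds) (fromDigits es))
ones-unique (suc zero ∷ ds) (zero ∷ es)     eq = contradiction (sym eq) (*2≢suc-*2 (fromDigits es) (fromDigits ds))
ones-unique (suc zero ∷ ds) (suc zero ∷ es) eq =
  cong suc (ones-unique ds es (ℕ.*-cancelʳ-≡ _ _ 2 (ℕ.suc-injective eq)))

-- Allows the digit count to be read off any expansion; the recurrences for `t` then come from
-- prepending one digit to an expansion of j.
binaryOnes-unique : ∀ n ds → fromDigits ds ≡ n → binaryOnes n ≡ ones ds
binaryOnes-unique n ds eq =
  ones-unique (proj₁ (toDigits 2 n)) ds (trans (proj₂ (toDigits 2 n)) (sym eq))

fromDigits-double : ∀ j → fromDigits (proj₁ (toDigits 2 j)) ℕ.* 2 ≡ j ℕ.+ j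
fromDigits-double j = begin
  fromDigits (proj₁ (toDigits 2 j)) ℕ.* 2  ≡⟨ cong (ℕ._* 2) (proj₂ (toDigits 2 j)) ⟩
  j ℕ.* 2                                  ≡⟨ ℕ.*-comm j 2 ⟩
  2 ℕ.* j                                  ≡⟨ cong (j ℕ.+_) (ℕ.+-identityʳ j) ⟩
  j ℕ.+ j                                  ∎

-- The Thue-Morse sequence in its ±1 form: 1 on `A` and -1 on `B`.
t : ℕ → ℤ
t n = -1ℤ ^ binaryOnes n

t-double : ∀ j → t (j ℕ.+ j) ≡ t j
t-double j = cong (-1ℤ ^_) (binaryOnes-unique (j ℕ.+ j) (zero ∷ proj₁ (toDigits 2 j)) (fromDigits-double j))

t-suc-double : ∀ j → t (suc (j ℕ.+ j)) ≡ - t j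
t-suc-double j = trans
  (cong (-1ℤ ^_) (binaryOnes-unique (suc (j ℕ.+ j)) (suc zero ∷ proj₁ (toDigits 2 j)) (cong suc (fromDigits-double j))))
  (ℤ.-1*i≡-i (t j))

sign-parity : ∀ k → (2 ∣ k × -1ℤ ^ k ≡ 1ℤ) ⊎ (¬ 2 ∣ k × -1ℤ ^ k ≡ -1ℤ)
sign-parity 0 = inj₁ (2 ∣0 , refl)
sign-parity 1 = inj₂ ((λ 2∣1 → contradiction (∣1⇒≡1 2∣1) λ ()) , refl)
sign-parity (suc (suc k)) with sign-parity k
... | inj₁ (2∣k , eq) = inj₁ (∣m∣n⇒∣m+n ∣-refl 2∣k , cong (λ x → -1ℤ * (-1ℤ * x)) eq)
... | inj₂ (2∤k , eq) = inj₂ ((λ 2∣2+k → 2∤k (∣m+n∣m⇒∣n 2∣2+k ∣-refl)) , cong (λ x → -1ℤ * (-1ℤ * x)) eq)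

t-values : ∀ n → (A n × t n ≡ 1ℤ) ⊎ (B n × t n ≡ -1ℤ)
t-values n = sign-parity (binaryOnes n)

t≡1⇒A : ∀ n → t n ≡ 1ℤ → n ∈ A
t≡1⇒A n t≡1 with t-values n
... | inj₁ (n∈A , _)    = n∈A
... | inj₂ (_ , t≡-1) = contradiction (trans (sym t≡1) t≡-1) λ ()

t≡-1⇒B : ∀ n → t n ≡ -1ℤ → n ∈ B
t≡-1⇒B n t≡-1 with t-values n
... | inj₁ (_ , t≡1) = contradiction (trans (sym t≡1) t≡-1) λ ()
... | inj₂ (n∈B , _) = n∈B

A⇒t≡1 : ∀ n → n ∈ A → t n ≡ 1ℤ
A⇒t≡1 n n∈A with t-values n
... | inj₁ (_ , t≡1) = t≡1
... | inj₂ (n∈B , _) = contradiction n∈A n∈B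

B⇒t≡-1 : ∀ n → n ∈ B → t n ≡ -1ℤ
B⇒t≡-1 n n∈B with t-values n
... | inj₁ (n∈A , _)  = contradiction n∈A n∈B
... | inj₂ (_ , t≡-1) = t≡-1

-- Removing the last binary digit stays within [0,m], and there p obeys the same recurrences as `t`.
-- The factor `p 0` is kept general because the reversal of p, which starts at `p m`, is treated as
-- well.
doubling⇒multiple-of-t :
  ∀ m (p : ℕ → ℤ) →
  (∀ j → j ℕ.+ j ≤ m → p (j ℕ.+ j) ≡ p j) →
  (∀ j → suc (j ℕ.+ j) ≤ m → p (suc (j ℕ.+ j)) ≡ - p j) →
  ∀ i → i ≤ m → p i ≡ p 0 * t i
doubling⇒multiple-of-t m p even odd = binary-induction (λ i → i ≤ m → p i ≡ p 0 * t i)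
  (λ _ → sym (ℤ.*-identityʳ (p 0)))
  (λ j ih 2j≤m → begin
    p (suc j ℕ.+ suc j)        ≡⟨ even (suc j) 2j≤m ⟩
    p (suc j)                  ≡⟨ ih (ℕ.≤-trans (n≤n+n (suc j)) 2j≤m) ⟩
    p 0 * t (suc j)            ≡⟨ cong (p 0 *_) (t-double (suc j)) ⟨
    p 0 * t (suc j ℕ.+ suc j)  ∎)
  (λ j ih 1+2j≤m → begin
    p (suc (j ℕ.+ j))        ≡⟨ odd j 1+2j≤m ⟩
    - p j                    ≡⟨ cong -_ (ih (ℕ.≤-trans (ℕ.m≤n⇒m≤1+n (n≤n+n j)) 1+2j≤m)) ⟩
    - (p 0 * t j)            ≡⟨ ℤ.neg-distribʳ-* (p 0) (t j) ⟩
    p 0 * - t j              ≡⟨ cong (p 0 *_) (t-suc-double j) ⟨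
    p 0 * t (suc (j ℕ.+ j))  ∎)

-- Reflection symmetry of the Thue-Morse sequence

Symmetric : ℕ → Set
Symmetric m = ∀ i j → i ℕ.+ j ≡ m → t i * t j ≡ t m

neg≢ : ∀ n → - t n ≢ t n
neg≢ n eq with t n | t-values n
... | _ | inj₁ (_ , refl) = contradiction eq λ ()
... | _ | inj₂ (_ , refl) = contradiction eq λ ()

-- For m = 2k + 2, compare the splittings 1 + (2k + 1) and 2 + 2k. Since t(1) = t(2) while t(2k + 1)
-- = -t(2k), the two products have opposite signs, yet both would equal t(m).
Symmetric-even : ∀ k → ¬ Symmetric (suc k ℕ.+ suc k)
Symmetric-even k sym-m = neg≢ (suc k) (begin
  - t (suc k)                  ≡⟨ cong -_ (t-double (suc k)) ⟨
  - t (suc k ℕ.+ suc k)        ≡⟨ cong -_ (sym-m 1 (suc (k ℕ.+ k)) (cong suc (sym (ℕ.+-suc k k)))) ⟨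
  - (-1ℤ * t (suc (k ℕ.+ k)))  ≡⟨ cong (λ x → - (-1ℤ * x)) (t-suc-double k) ⟩
  - (-1ℤ * - t k)              ≡⟨ signs (t k) ⟩
  -1ℤ * t k                    ≡⟨ cong (-1ℤ *_) (t-double k) ⟨
  -1ℤ * t (k ℕ.+ k)            ≡⟨ sym-m 2 (k ℕ.+ k) (cong suc (sym (ℕ.+-suc k k))) ⟩
  t (suc k ℕ.+ suc k)          ≡⟨ t-double (suc k) ⟩
  t (suc k)                    ∎)
  where
  signs : ∀ x → - (-1ℤ * - x) ≡ -1ℤ * x
  signs = solve-∀

-- A splitting i + j = k lifts to 2i + (2j + 1) = 2k + 1, and the appended digit 1 negates both
-- sides.
Symmetric-odd⁻ : ∀ k → Symmetric (suc (k ℕ.+ k)) → Symmetric k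
Symmetric-odd⁻ k sym-m i j refl = ℤ.neg-injective (begin
  - (t i * t j)                      ≡⟨ ℤ.neg-distribʳ-* (t i) (t j) ⟩
  t i * - t j                        ≡⟨ cong₂ _*_ (t-double i) (t-suc-double j) ⟨
  t (i ℕ.+ i) * t (suc (j ℕ.+ j))    ≡⟨ sym-m (i ℕ.+ i) (suc (j ℕ.+ j)) (double-+ i j) ⟩
  t (suc ((i ℕ.+ j) ℕ.+ (i ℕ.+ j)))  ≡⟨ t-suc-double (i ℕ.+ j) ⟩
  - t (i ℕ.+ j)                      ∎)
  where
  double-+ : ∀ i j → (i ℕ.+ i) ℕ.+ suc (j ℕ.+ j) ≡ suc ((i ℕ.+ j) ℕ.+ (i ℕ.+ j))
  double-+ = solveℕ-∀

-- Exactly one summand of 2k + 1 is odd. Dropping the last digits leaves a splitting of k and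
-- changes the sign on both sides once.
Symmetric-odd⁺ : ∀ k → Symmetric k → Symmetric (suc (k ℕ.+ k))
Symmetric-odd⁺ k sym-k i j i+j≡1+2k with halve i | halve j
... | i′ , inj₁ refl | j′ , inj₁ refl =
  contradiction (trans (double-+ i′ j′) i+j≡1+2k) (double≢suc-double (i′ ℕ.+ j′) k)
  where
  double-+ : ∀ i j → (i ℕ.+ j) ℕ.+ (i ℕ.+ j) ≡ (i ℕ.+ i) ℕ.+ (j ℕ.+ j)
  double-+ = solveℕ-∀
... | i′ , inj₂ refl | j′ , inj₂ refl =
  contradiction (trans (double-+ i′ j′) i+j≡1+2k) (double≢suc-double (suc (i′ ℕ.+ j′)) k)
  where
  double-+ : ∀ i j → suc (i ℕ.+ j) ℕ.+ suc (i ℕ.+ j) ≡ suc (i ℕ.+ i) ℕ.+ suc (j ℕ.+ j)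
  double-+ = solveℕ-∀
... | i′ , inj₁ refl | j′ , inj₂ refl = begin
  t (i′ ℕ.+ i′) * t (suc (j′ ℕ.+ j′))  ≡⟨ cong₂ _*_ (t-double i′) (t-suc-double j′) ⟩
  t i′ * - t j′                        ≡⟨ ℤ.neg-distribʳ-* (t i′) (t j′) ⟨
  - (t i′ * t j′)                      ≡⟨ cong -_ (sym-k i′ j′ (double-injective (ℕ.suc-injective (trans (double-+ i′ j′) i+j≡1+2k)))) ⟩
  - t k                                ≡⟨ t-suc-double k ⟨
  t (suc (k ℕ.+ k))                    ∎
  where
  double-+ : ∀ i j → suc ((i ℕ.+ j) ℕ.+ (i ℕ.+ j)) ≡ (i ℕ.+ i) ℕ.+ suc (j ℕ.+ j)
  double-+ = solveℕ-∀
... | i′ , inj₂ refl | j′ , inj₁ refl = begin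
  t (suc (i′ ℕ.+ i′)) * t (j′ ℕ.+ j′)  ≡⟨ cong₂ _*_ (t-suc-double i′) (t-double j′) ⟩
  - t i′ * t j′                        ≡⟨ ℤ.neg-distribˡ-* (t i′) (t j′) ⟨
  - (t i′ * t j′)                      ≡⟨ cong -_ (sym-k i′ j′ (double-injective (ℕ.suc-injective (trans (double-+ i′ j′) i+j≡1+2k)))) ⟩
  - t k                                ≡⟨ t-suc-double k ⟨
  t (suc (k ℕ.+ k))                    ∎
  where
  double-+ : ∀ i j → suc ((i ℕ.+ j) ℕ.+ (i ℕ.+ j)) ≡ suc (i ℕ.+ i) ℕ.+ (j ℕ.+ j)
  double-+ = solveℕ-∀

suc[2^l∸1] : ∀ l → suc (2 ℕ.^ l ∸ 1) ≡ 2 ℕ.^ l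
suc[2^l∸1] l = ℕ.m+[n∸m]≡n (ℕ.m^n>0 2 l)

2^[1+l]∸1 : ∀ l → 2 ℕ.^ suc l ∸ 1 ≡ suc ((2 ℕ.^ l ∸ 1) ℕ.+ (2 ℕ.^ l ∸ 1))
2^[1+l]∸1 l = begin
  2 ℕ.* 2 ℕ.^ l ∸ 1                            ≡⟨ cong (λ k → 2 ℕ.* k ∸ 1) (suc[2^l∸1] l) ⟨
  -- `2 * suc k ∸ 1` computes to `k + suc (k + 0)`, the form in which `pred-double` is stated.
  2 ℕ.* suc (2 ℕ.^ l ∸ 1) ∸ 1                  ≡⟨ pred-double (2 ℕ.^ l ∸ 1) ⟩
  suc ((2 ℕ.^ l ∸ 1) ℕ.+ (2 ℕ.^ l ∸ 1))        ∎
  where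
  pred-double : ∀ k → k ℕ.+ suc (k ℕ.+ 0) ≡ suc (k ℕ.+ k)
  pred-double = solveℕ-∀

-- A symmetric m is 0 or odd, and in the odd case stripping its last digit 1 keeps it symmetric.
-- Hence all its binary digits are 1, and each stripped digit raises l by one.
Symmetric⇒2^l∸1 : ∀ m → Symmetric m → ∃[ l ] m ≡ 2 ℕ.^ l ∸ 1
Symmetric⇒2^l∸1 = binary-induction (λ m → Symmetric m → ∃[ l ] m ≡ 2 ℕ.^ l ∸ 1)
  (λ _ → 0 , refl)
  (λ k _ sym-m → contradiction sym-m (Symmetric-even k))
  (λ k ih sym-m → let l , k≡2^l∸1 = ih (Symmetric-odd⁻ k sym-m) in
    suc l , trans (cong (λ k → suc (k ℕ.+ k)) k≡2^l∸1) (sym (2^[1+l]∸1 l)))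

2^l∸1-Symmetric : ∀ l → Symmetric (2 ℕ.^ l ∸ 1)
2^l∸1-Symmetric zero    zero zero refl = refl
2^l∸1-Symmetric (suc l) = subst Symmetric (sym (2^[1+l]∸1 l)) (Symmetric-odd⁺ _ (2^l∸1-Symmetric l))

t²≡1 : ∀ n → t n * t n ≡ 1ℤ
t²≡1 n with t n | t-values n
... | _ | inj₁ (_ , refl) = refl
... | _ | inj₂ (_ , refl) = refl

-- The sum `H` over pairs of distinct elements, and its reflection

-- Those i ∈ [0,m] for which (i, n − i) is a pair of distinct elements of [0,m].
Active : ℕ → ℕ → Pred ℕ 0ℓ
Active m n i = i ≤ n × n ≤ m ℕ.+ i × i ℕ.+ i ≢ n

active? : ∀ m n → Decidable (Active m n)
active? m n i = (i ℕ.≤? n) ×-dec (n ℕ.≤? m ℕ.+ i) ×-dec ¬? (i ℕ.+ i ℕ.≟ n)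

-- For p = 1_C − 1_D this is 2 (R_C n − R_D n).
H : ℕ → (ℕ → ℤ) → ℕ → ℤ
H m p n = ∑ (suc m) (λ i → p i * 𝟙 (active? m n i))

*𝟙-no : ∀ x (P? : Dec P) → ¬ P → x * 𝟙 P? ≡ 0ℤ
*𝟙-no x P? ¬p = trans (cong (x *_) (𝟙-no P? ¬p)) (ℤ.*-zeroʳ x)

*𝟙-yes : ∀ x (P? : Dec P) → P → x * 𝟙 P? ≡ x
*𝟙-yes x P? p = trans (cong (x *_) (𝟙-yes P? p)) (ℤ.*-identityʳ x)

H-cong : ∀ m {p q : ℕ → ℤ} n → (∀ i → i ≤ m → p i ≡ q i) → H m p n ≡ H m q n
H-cong m n eq = ∑-cong (suc m) λ i i<1+m → cong (_* 𝟙 (active? m n i)) (eq i (ℕ.s≤s⁻¹ i<1+m))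

H-scale : ∀ m x (p : ℕ → ℤ) n → H m (λ i → x * p i) n ≡ x * H m p n
H-scale m x p n = trans
  (∑-cong (suc m) λ i _ → ℤ.*-assoc x (p i) (𝟙 (active? m n i)))
  (*-distribˡ-∑ (suc m) x (λ i → p i * 𝟙 (active? m n i)))

H-zero : ∀ m p → H m p 0 ≡ 0ℤ
H-zero m p = ∑-zero (suc m) λ i _ → *𝟙-no (p i) (active? m 0 i)
  λ (i≤0 , _ , 2i≢0) → 2i≢0 (cong (λ k → k ℕ.+ k) (ℕ.n≤0⇒n≡0 i≤0))

H-beyond : ∀ m p n → m ℕ.+ m < n → H m p n ≡ 0ℤ
H-beyond m p n 2m<n = ∑-zero (suc m) λ i i<1+m → *𝟙-no (p i) (active? m n i)
  λ (_ , n≤m+i , _) → ℕ.<⇒≱ 2m<n (ℕ.≤-trans n≤m+i (ℕ.+-monoʳ-≤ m (ℕ.s≤s⁻¹ i<1+m)))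

-- With m = i + j and n′ = 2m - n, the bound i ≤ n turns into n′ ≤ m + j, the bound n ≤ m + i into j
-- ≤ n′, and 2i ≠ n into 2j ≠ n′. Writing m as i + j keeps subtraction out of the argument.
Active-reverse : ∀ {n n′} i j → n ℕ.+ n′ ≡ (i ℕ.+ j) ℕ.+ (i ℕ.+ j) →
                 Active (i ℕ.+ j) n i → Active (i ℕ.+ j) n′ j
Active-reverse {n} {n′} i j n+n′≡2m (i≤n , n≤m+i , 2i≢n) =
  ℕ.+-cancelˡ-≤ n j n′ (ℕ.≤-trans (ℕ.+-monoˡ-≤ j n≤m+i)
    (ℕ.≤-reflexive (trans (ℕ.+-assoc (i ℕ.+ j) i j) (sym n+n′≡2m)))) ,
  ℕ.+-cancelˡ-≤ i n′ ((i ℕ.+ j) ℕ.+ j) (ℕ.≤-trans (ℕ.+-monoˡ-≤ n′ i≤n)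
    (ℕ.≤-reflexive (trans n+n′≡2m (shuffle i j)))) ,
  λ 2j≡n′ → 2i≢n (ℕ.+-cancelʳ-≡ (j ℕ.+ j) (i ℕ.+ i) n (begin
    (i ℕ.+ i) ℕ.+ (j ℕ.+ j)      ≡⟨ interchange i j ⟩
    (i ℕ.+ j) ℕ.+ (i ℕ.+ j)      ≡⟨ n+n′≡2m ⟨
    n ℕ.+ n′                     ≡⟨ cong (n ℕ.+_) 2j≡n′ ⟨
    n ℕ.+ (j ℕ.+ j)              ∎))
  where
  shuffle : ∀ i j → (i ℕ.+ j) ℕ.+ (i ℕ.+ j) ≡ i ℕ.+ ((i ℕ.+ j) ℕ.+ j)
  shuffle = solveℕ-∀
  interchange : ∀ i j → (i ℕ.+ i) ℕ.+ (j ℕ.+ j) ≡ (i ℕ.+ j) ℕ.+ (i ℕ.+ j)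
  interchange = solveℕ-∀

H-reverse : ∀ m p n → n ≤ m ℕ.+ m → H m (λ i → p (m ∸ i)) n ≡ H m p (m ℕ.+ m ∸ n)
H-reverse m p n n≤2m = trans
  (∑-cong (suc m) λ i i<1+m →
    cong (p (m ∸ i) *_) (𝟙-reverse i (m ∸ i) (ℕ.m+[n∸m]≡n (ℕ.s≤s⁻¹ i<1+m))))
  (∑-reverse m (λ i → p i * 𝟙 (active? m n′ i)))
  where
  n′ = m ℕ.+ m ∸ n

  n+n′≡2m : n ℕ.+ n′ ≡ m ℕ.+ m
  n+n′≡2m = ℕ.m+[n∸m]≡n n≤2m

  reverse-⇒ : ∀ {n n′} i j → i ℕ.+ j ≡ m → n ℕ.+ n′ ≡ m ℕ.+ m → Active m n i → Active m n′ j
  reverse-⇒ i j refl = Active-reverse i j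

  𝟙-reverse : ∀ i j → i ℕ.+ j ≡ m → 𝟙 (active? m n i) ≡ 𝟙 (active? m n′ j)
  𝟙-reverse i j i+j≡m = 𝟙-⇔ (active? m n i) (active? m n′ j)
    -- The hypotheses are symmetric under exchanging (i, n) with (j, n′), so one implication serves
    -- both directions.
    (reverse-⇒ i j i+j≡m n+n′≡2m)
    (reverse-⇒ j i (trans (ℕ.+-comm j i) i+j≡m) (trans (ℕ.+-comm n′ n) n+n′≡2m))

-- This is p(n/2) for even n and 0 for odd n, written as a sum so that it can be added to `H` term
-- by term.
diagonal : (ℕ → ℤ) → ℕ → ℤ
diagonal p n = ∑ (suc n) (λ i → p i * 𝟙 (i ℕ.+ i ℕ.≟ n))

diagonal-even : ∀ p j → diagonal p (j ℕ.+ j) ≡ p j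
diagonal-even p j = trans
  (∑-single _ j (s≤s (n≤n+n j)) λ i i≢j → *𝟙-no (p i) (i ℕ.+ i ℕ.≟ j ℕ.+ j) (i≢j ∘ double-injective))
  (*𝟙-yes (p j) (j ℕ.+ j ℕ.≟ j ℕ.+ j) refl)

diagonal-odd : ∀ p j → diagonal p (suc (j ℕ.+ j)) ≡ 0ℤ
diagonal-odd p j = ∑-zero (suc (suc (j ℕ.+ j))) λ i _ →
  *𝟙-no (p i) (i ℕ.+ i ℕ.≟ suc (j ℕ.+ j)) (double≢suc-double i j)

-- For n ≤ m the condition n ≤ m + i is automatic, so `H` omits from the prefix sum only the index
-- with 2i = n, which the diagonal restores.
H+diagonal : ∀ m p n → n ≤ m → H m p n + diagonal p n ≡ ∑ (suc n) p
H+diagonal m p n n≤m = begin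
  H m p n + diagonal p n
    ≡⟨ cong (λ k → ∑ (suc k) hit + diagonal p n) (ℕ.m∸n+n≡m n≤m) ⟨
  ∑ (suc (m ∸ n ℕ.+ n)) hit + diagonal p n
    ≡⟨ cong (λ k → ∑ k hit + diagonal p n) (ℕ.+-suc (m ∸ n) n) ⟨
  ∑ (m ∸ n ℕ.+ suc n) hit + diagonal p n
    ≡⟨ cong (_+ diagonal p n) (∑-extend (m ∸ n) (suc n) λ i n<i →
         *𝟙-no (p i) (active? m n i) λ (i≤n , _) → ℕ.<⇒≱ n<i i≤n) ⟩
  ∑ (suc n) hit + diagonal p n
    ≡⟨ ∑-distrib-+ (suc n) hit (λ i → p i * 𝟙 (i ℕ.+ i ℕ.≟ n)) ⟨
  ∑ (suc n) (λ i → hit i + p i * 𝟙 (i ℕ.+ i ℕ.≟ n))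
    ≡⟨ ∑-cong (suc n) (λ i i<1+n → merge i (ℕ.s≤s⁻¹ i<1+n)) ⟩
  ∑ (suc n) p
    ∎
  where
  hit : ℕ → ℤ
  hit i = p i * 𝟙 (active? m n i)

  merge : ∀ i → i ≤ n → hit i + p i * 𝟙 (i ℕ.+ i ℕ.≟ n) ≡ p i
  merge i i≤n with i ℕ.+ i ℕ.≟ n
  ... | yes 2i≡n = trans
    (cong₂ _+_ (*𝟙-no (p i) (active? m n i) λ (_ , _ , 2i≢n) → 2i≢n 2i≡n) (*𝟙-yes (p i) (i ℕ.+ i ℕ.≟ n) 2i≡n))
    (ℤ.+-identityˡ (p i))
  ... | no  2i≢n = trans
    (cong₂ _+_ (*𝟙-yes (p i) (active? m n i) (i≤n , ℕ.≤-trans n≤m (ℕ.m≤m+n m i) , 2i≢n)) (*𝟙-no (p i) (i ℕ.+ i ℕ.≟ n) 2i≢n))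
    (ℤ.+-identityʳ (p i))

-- Vanishing of `H` forces the Thue-Morse sequence and its symmetry

-- Each prefix sum equals its diagonal term: p(j) when it ends at 2j, and 0 when it ends at 2j + 1.
-- Differences of consecutive prefix sums give the doubling recurrences.
H≡0⇒multiple-of-t : ∀ m p → (∀ n → 0 < n → n ≤ m → H m p n ≡ 0ℤ) →
                    ∀ i → i ≤ m → p i ≡ p 0 * t i
H≡0⇒multiple-of-t m p H≡0 = doubling⇒multiple-of-t m p even odd
  where
  prefix : ∀ n → n ≤ m → ∑ (suc n) p ≡ diagonal p n
  prefix n n≤m = begin
    ∑ (suc n) p             ≡⟨ H+diagonal m p n n≤m ⟨
    H m p n + diagonal p n  ≡⟨ cong (_+ diagonal p n) (vanishes n n≤m) ⟩
    0ℤ + diagonal p n       ≡⟨ ℤ.+-identityˡ (diagonal p n) ⟩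
    diagonal p n            ∎
    where
    vanishes : ∀ n → n ≤ m → H m p n ≡ 0ℤ
    -- The hypothesis starts at n = 1; at n = 0 the only candidate index lies on the diagonal.
    vanishes zero    _ = H-zero m p
    vanishes (suc n)   = H≡0 (suc n) (s≤s z≤n)

  prefix-odd : ∀ j → suc (j ℕ.+ j) ≤ m → ∑ (suc (suc (j ℕ.+ j))) p ≡ 0ℤ
  prefix-odd j 1+2j≤m = trans (prefix (suc (j ℕ.+ j)) 1+2j≤m) (diagonal-odd p j)

  prefix-even : ∀ j → j ℕ.+ j ≤ m → ∑ (suc (j ℕ.+ j)) p ≡ p j
  prefix-even j 2j≤m = trans (prefix (j ℕ.+ j) 2j≤m) (diagonal-even p j)

  even : ∀ j → j ℕ.+ j ≤ m → p (j ℕ.+ j) ≡ p j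
  even zero    _    = refl
  even (suc j) 2j≤m = begin
    p (suc j ℕ.+ suc j)                            ≡⟨ ℤ.+-identityˡ _ ⟨
    0ℤ + p (suc j ℕ.+ suc j)                       ≡⟨ cong (_+ p (suc j ℕ.+ suc j)) earlier ⟨
    ∑ (suc j ℕ.+ suc j) p + p (suc j ℕ.+ suc j)    ≡⟨ prefix-even (suc j) 2j≤m ⟩
    p (suc j)                                      ∎
    where
    2j≡ : suc j ℕ.+ suc j ≡ suc (suc (j ℕ.+ j))
    2j≡ = cong suc (ℕ.+-suc j j)

    -- The 2j + 2 terms end at the odd index 2j + 1.
    earlier : ∑ (suc j ℕ.+ suc j) p ≡ 0ℤ
    earlier = trans (cong (λ k → ∑ k p) 2j≡)
      (prefix-odd j (ℕ.≤-trans (ℕ.n≤1+n _) (subst (_≤ m) 2j≡ 2j≤m)))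

  odd : ∀ j → suc (j ℕ.+ j) ≤ m → p (suc (j ℕ.+ j)) ≡ - p j
  odd j 1+2j≤m = begin
    p (suc (j ℕ.+ j))                  ≡⟨ cancel (p j) (p (suc (j ℕ.+ j))) ⟩
    (p j + p (suc (j ℕ.+ j))) - p j    ≡⟨ cong (λ x → (x + p (suc (j ℕ.+ j))) - p j) (prefix-even j (ℕ.≤-trans (ℕ.n≤1+n _) 1+2j≤m)) ⟨
    ∑ (suc (suc (j ℕ.+ j))) p - p j    ≡⟨ cong (_- p j) (prefix-odd j 1+2j≤m) ⟩
    0ℤ - p j                           ≡⟨ ℤ.+-identityˡ (- p j) ⟩
    - p j                              ∎
    where
    cancel : ∀ x y → y ≡ (x + y) - x
    cancel = solve-∀

H≡0⇒t : ∀ m p → p 0 ≡ 1ℤ → (∀ n → 0 < n → H m p n ≡ 0ℤ) → ∀ i → i ≤ m → p i ≡ t i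
H≡0⇒t m p p₀≡1 H≡0 i i≤m = begin
  p i        ≡⟨ H≡0⇒multiple-of-t m p (λ n 0<n _ → H≡0 n 0<n) i i≤m ⟩
  p 0 * t i  ≡⟨ cong (_* t i) p₀≡1 ⟩
  1ℤ * t i   ≡⟨ ℤ.*-identityˡ (t i) ⟩
  t i        ∎

-- Both p and its reversal satisfy the low-range vanishing, so p(m - i) = p(m) t(i). With p = t on
-- [0,m], multiplying by t(i) and using t(i)² = 1 gives the symmetry.
H≡0⇒Symmetric : ∀ m p → p 0 ≡ 1ℤ → (∀ n → 0 < n → H m p n ≡ 0ℤ) → Symmetric m
H≡0⇒Symmetric m p p₀≡1 H≡0 i j i+j≡m = begin
  t i * t j          ≡⟨ cong (t i *_) (H≡0⇒t m p p₀≡1 H≡0 j j≤m) ⟨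
  t i * p j          ≡⟨ cong (λ k → t i * p k) (trans (cong (_∸ i) (sym i+j≡m)) (ℕ.m+n∸m≡n i j)) ⟨
  t i * p (m ∸ i)    ≡⟨ cong (t i *_) (H≡0⇒multiple-of-t m (λ k → p (m ∸ k)) reversed i i≤m) ⟩
  t i * (p m * t i)  ≡⟨ rearrange (t i) (p m) ⟩
  p m * (t i * t i)  ≡⟨ cong (p m *_) (t²≡1 i) ⟩
  p m * 1ℤ           ≡⟨ ℤ.*-identityʳ (p m) ⟩
  p m                ≡⟨ H≡0⇒t m p p₀≡1 H≡0 m ℕ.≤-refl ⟩
  t m                ∎
  where
  i≤m : i ≤ m
  i≤m = subst (i ≤_) i+j≡m (ℕ.m≤m+n i j)

  j≤m : j ≤ m
  j≤m = subst (j ≤_) i+j≡m (ℕ.m≤n+m j i)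

  rearrange : ∀ x y → x * (y * x) ≡ y * (x * x)
  rearrange = solve-∀

  reversed : ∀ n → 0 < n → n ≤ m → H m (λ k → p (m ∸ k)) n ≡ 0ℤ
  reversed n 0<n n≤m = trans
    (H-reverse m p n (ℕ.≤-trans n≤m (n≤n+n m)))
    -- The reflected index is positive because n ≤ m < 2m.
    (H≡0 (m ℕ.+ m ∸ n) (ℕ.m<n⇒0<n∸m (ℕ.≤-<-trans n≤m (ℕ.m<m+n m (ℕ.<-≤-trans 0<n n≤m)))))

-- Vanishing of `H` for the Thue-Morse sequence

∑-t-even : ∀ j → ∑ (j ℕ.+ j) t ≡ 0ℤ
∑-t-even zero    = refl
∑-t-even (suc j) = begin
  ∑ (suc j ℕ.+ suc j) t                                 ≡⟨ cong (λ k → ∑ (suc k) t) (ℕ.+-suc j j) ⟩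
  (∑ (j ℕ.+ j) t + t (j ℕ.+ j)) + t (suc (j ℕ.+ j))     ≡⟨ cong₂ _+_ (cong₂ _+_ (∑-t-even j) (t-double j)) (t-suc-double j) ⟩
  (0ℤ + t j) + - t j                                    ≡⟨ cong (_+ - t j) (ℤ.+-identityˡ (t j)) ⟩
  t j + - t j                                           ≡⟨ ℤ.+-inverseʳ (t j) ⟩
  0ℤ                                                    ∎

-- The terms at 2i and 2i + 1 cancel. An even n leaves its last term t(n) = t(n/2), an odd n leaves
-- nothing.
∑-t : ∀ n → ∑ (suc n) t ≡ diagonal t n
∑-t n with halve n
... | j , inj₁ refl = begin
  ∑ (j ℕ.+ j) t + t (j ℕ.+ j)  ≡⟨ cong₂ _+_ (∑-t-even j) (t-double j) ⟩
  0ℤ + t j                     ≡⟨ ℤ.+-identityˡ (t j) ⟩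
  t j                          ≡⟨ diagonal-even t j ⟨
  diagonal t (j ℕ.+ j)         ∎
... | j , inj₂ refl = begin
  ∑ (suc (suc (j ℕ.+ j))) t    ≡⟨ cong (λ k → ∑ (suc k) t) (ℕ.+-suc j j) ⟨
  ∑ (suc j ℕ.+ suc j) t        ≡⟨ ∑-t-even (suc j) ⟩
  0ℤ                           ≡⟨ diagonal-odd t j ⟨
  diagonal t (suc (j ℕ.+ j))   ∎

H-t-low : ∀ m n → n ≤ m → H m t n ≡ 0ℤ
H-t-low m n n≤m = ∙-cancelʳ (diagonal t n) (H m t n) 0ℤ (begin
  H m t n + diagonal t n  ≡⟨ H+diagonal m t n n≤m ⟩
  ∑ (suc n) t             ≡⟨ ∑-t n ⟩
  diagonal t n            ≡⟨ ℤ.+-identityˡ (diagonal t n) ⟨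
  0ℤ + diagonal t n       ∎)

-- Beyond 2m no pair exists. For m < n ≤ 2m, reflection leads to n′ = 2m - n ≤ m, and symmetry makes
-- the reversed sequence t(m) times `t`, so the low range decides.
Symmetric⇒H-t≡0 : ∀ m → Symmetric m → ∀ n → H m t n ≡ 0ℤ
Symmetric⇒H-t≡0 m sym-m n with n ℕ.≤? m | n ℕ.≤? m ℕ.+ m
... | yes n≤m | _        = H-t-low m n n≤m
... | no _    | no n≰2m  = H-beyond m t n (ℕ.≰⇒> n≰2m)
... | no n≰m  | yes n≤2m = begin
  H m t n                      ≡⟨ cong (H m t) (ℕ.m∸[m∸n]≡n n≤2m) ⟨
  H m t (m ℕ.+ m ∸ n′)         ≡⟨ H-reverse m t n′ (ℕ.m∸n≤m (m ℕ.+ m) n) ⟨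
  H m (λ i → t (m ∸ i)) n′     ≡⟨ H-cong m n′ reversed ⟩
  H m (λ i → t m * t i) n′     ≡⟨ H-scale m (t m) t n′ ⟩
  t m * H m t n′               ≡⟨ cong (t m *_) (H-t-low m n′ n′≤m) ⟩
  t m * 0ℤ                     ≡⟨ ℤ.*-zeroʳ (t m) ⟩
  0ℤ                           ∎
  where
  n′ = m ℕ.+ m ∸ n

  n′≤m : n′ ≤ m
  n′≤m = subst (n′ ≤_) (ℕ.m+n∸n≡m m m) (ℕ.∸-monoʳ-≤ (m ℕ.+ m) (ℕ.<⇒≤ (ℕ.≰⇒> n≰m)))

  rearrange : ∀ x y → (x * y) * x ≡ y * (x * x)
  rearrange = solve-∀

  reversed : ∀ i → i ≤ m → t (m ∸ i) ≡ t m * t i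
  reversed i i≤m = begin
    t (m ∸ i)                ≡⟨ ℤ.*-identityʳ (t (m ∸ i)) ⟨
    t (m ∸ i) * 1ℤ           ≡⟨ cong (t (m ∸ i) *_) (t²≡1 i) ⟨
    t (m ∸ i) * (t i * t i)  ≡⟨ rearrange (t i) (t (m ∸ i)) ⟨
    (t i * t (m ∸ i)) * t i  ≡⟨ cong (_* t i) (sym-m i (m ∸ i) (ℕ.m+[n∸m]≡n i≤m)) ⟩
    t m * t i                ∎

-- Representation counts of a partition in terms of `H`

𝟙-distinct : ∀ i j → 𝟙 (i ℕ.<? j) + 𝟙 (j ℕ.<? i) ≡ 𝟙 (¬? (i ℕ.≟ j))
𝟙-distinct i j with ℕ.<-cmp i j
... | tri< i<j i≢j j≮i = trans (cong₂ _+_ (𝟙-yes (i ℕ.<? j) i<j) (𝟙-no (j ℕ.<? i) j≮i)) (sym (𝟙-yes (¬? (i ℕ.≟ j)) i≢j))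
... | tri≈ i≮j i≡j j≮i = trans (cong₂ _+_ (𝟙-no (i ℕ.<? j) i≮j) (𝟙-no (j ℕ.<? i) j≮i)) (sym (𝟙-no (¬? (i ℕ.≟ j)) λ i≢j → i≢j i≡j))
... | tri> i≮j i≢j j<i = trans (cong₂ _+_ (𝟙-no (i ℕ.<? j) i≮j) (𝟙-yes (j ℕ.<? i) j<i)) (sym (𝟙-yes (¬? (i ℕ.≟ j)) i≢j))

-- With n = i + j, the condition n ≤ m + i reads j ≤ m, and 2i ≠ n reads i ≠ j; the two strict
-- orders together express i ≠ j.
𝟙-active : ∀ m i j → 𝟙 (j ℕ.≤? m) * (𝟙 (i ℕ.<? j) + 𝟙 (j ℕ.<? i)) ≡ 𝟙 (active? m (i ℕ.+ j) i)
𝟙-active m i j = begin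
  𝟙 (j ℕ.≤? m) * (𝟙 (i ℕ.<? j) + 𝟙 (j ℕ.<? i))  ≡⟨ cong (𝟙 (j ℕ.≤? m) *_) (𝟙-distinct i j) ⟩
  𝟙 (j ℕ.≤? m) * 𝟙 (¬? (i ℕ.≟ j))               ≡⟨ 𝟙-× (j ℕ.≤? m) (¬? (i ℕ.≟ j)) ⟨
  𝟙 ((j ℕ.≤? m) ×-dec ¬? (i ℕ.≟ j))             ≡⟨ 𝟙-⇔ ((j ℕ.≤? m) ×-dec ¬? (i ℕ.≟ j)) (active? m (i ℕ.+ j) i) to from ⟩
  𝟙 (active? m (i ℕ.+ j) i)                     ∎
  where
  to : j ≤ m × i ≢ j → Active m (i ℕ.+ j) i
  to (j≤m , i≢j) =
    ℕ.m≤m+n i j , subst (i ℕ.+ j ≤_) (ℕ.+-comm i m) (ℕ.+-monoʳ-≤ i j≤m) ,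
    λ 2i≡i+j → i≢j (ℕ.+-cancelˡ-≡ i i j 2i≡i+j)

  from : Active m (i ℕ.+ j) i → j ≤ m × i ≢ j
  from (_ , i+j≤m+i , 2i≢i+j) =
    ℕ.+-cancelˡ-≤ i j m (subst (i ℕ.+ j ≤_) (ℕ.+-comm m i) i+j≤m+i) ,
    λ i≡j → 2i≢i+j (cong (i ℕ.+_) i≡j)

module _ {c d} {C : Pred ℕ c} {D : Pred ℕ d} (C? : Decidable C) (D? : Decidable D)
         {m} (cover : C ∪ D ≐ [ 0 , m ]) (disjoint : C ∩ D ≐ ∅) where

  signed : ℕ → ℤ
  signed i = 𝟙 (C? i) - 𝟙 (D? i)

  signed-C : ∀ {i} → i ∈ C → signed i ≡ 1ℤ
  signed-C {i} i∈C = cong₂ _-_ (𝟙-yes (C? i) i∈C) (𝟙-no (D? i) λ i∈D → proj₁ disjoint (i∈C , i∈D))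

  signed-D : ∀ {i} → i ∈ D → signed i ≡ -1ℤ
  signed-D {i} i∈D = cong₂ _-_ (𝟙-no (C? i) λ i∈C → proj₁ disjoint (i∈C , i∈D)) (𝟙-yes (D? i) i∈D)

  signed-outside : ∀ {i} → m < i → signed i ≡ 0ℤ
  signed-outside {i} m<i = cong₂ _-_
    (𝟙-no (C? i) λ i∈C → ℕ.<⇒≱ m<i (proj₂ (proj₁ cover (inj₁ i∈C))))
    (𝟙-no (D? i) λ i∈D → ℕ.<⇒≱ m<i (proj₂ (proj₁ cover (inj₂ i∈D))))

  -- Turns the factors c + d produced by polarization into plain range conditions.
  𝟙-cover : ∀ i → 𝟙 (C? i) + 𝟙 (D? i) ≡ 𝟙 (i ℕ.≤? m)
  𝟙-cover i with i ℕ.≤? m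
  ... | no  i≰m = trans
    (cong₂ _+_ (𝟙-no (C? i) λ i∈C → i≰m (proj₂ (proj₁ cover (inj₁ i∈C))))
               (𝟙-no (D? i) λ i∈D → i≰m (proj₂ (proj₁ cover (inj₂ i∈D)))))
    (sym (𝟙-no (i ℕ.≤? m) i≰m))
  ... | yes i≤m = trans (exactly-one (proj₂ cover (z≤n , i≤m))) (sym (𝟙-yes (i ℕ.≤? m) i≤m))
    where
    exactly-one : i ∈ C ⊎ i ∈ D → 𝟙 (C? i) + 𝟙 (D? i) ≡ 1ℤ
    exactly-one (inj₁ i∈C) =
      cong₂ _+_ (𝟙-yes (C? i) i∈C) (𝟙-no (D? i) λ i∈D → proj₁ disjoint (i∈C , i∈D))
    exactly-one (inj₂ i∈D) =
      cong₂ _+_ (𝟙-no (C? i) λ i∈C → proj₁ disjoint (i∈C , i∈D)) (𝟙-yes (D? i) i∈D)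

  private
    U : ℕ → ℤ
    U i = 𝟙 (i ℕ.≤? m)

    L : ℕ → ℕ → ℤ
    L i j = 𝟙 (i ℕ.<? j)

    pair : ∀ {S : Pred ℕ ℓ} → Decidable S → ℕ → ℕ → ℤ
    pair S? n i = 𝟙 (S? i) * 𝟙 (S? (n ∸ i)) * L i (n ∸ i)

    -- Contributions of signed(i) to the pair {i, n - i}: `F` takes i as the smaller element, `F′`
    -- as the larger.
    F F′ : ℕ → ℕ → ℤ
    F  n i = signed i * U (n ∸ i) * L i (n ∸ i)
    F′ n i = signed i * U (n ∸ i) * L (n ∸ i) i

    -- Polarization: 2(cc′ - dd′) = (c - d)(c′ + d′) + (c′ - d′)(c + d), where each sum is the
    -- indicator of [0,m].
    expand : ∀ n i → i ≤ n → pair C? n i + pair C? n i ≡ (pair D? n i + pair D? n i) + (F n i + F′ n (n ∸ i))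
    expand n i i≤n = begin
      pair C? n i + pair C? n i
        ≡⟨ polarize (𝟙 (C? i)) (𝟙 (C? j)) (𝟙 (D? i)) (𝟙 (D? j)) (L i j) ⟩
      (pair D? n i + pair D? n i) +
      (signed i * (𝟙 (C? j) + 𝟙 (D? j)) * L i j + signed j * (𝟙 (C? i) + 𝟙 (D? i)) * L i j)
        ≡⟨ cong₂ (λ x y → (pair D? n i + pair D? n i) + (signed i * x * L i j + signed j * y * L i j)) (𝟙-cover j) (𝟙-cover i) ⟩
      (pair D? n i + pair D? n i) + (F n i + signed j * U i * L i j)
        -- Writing i as n - j exhibits the last term as `F′` at j.
        ≡⟨ cong (λ k → (pair D? n i + pair D? n i) + (F n i + signed j * U k * L k j)) (ℕ.m∸[m∸n]≡n i≤n) ⟨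
      (pair D? n i + pair D? n i) + (F n i + F′ n j)
        ∎
      where
      j = n ∸ i

      polarize : ∀ c c′ d d′ l → c * c′ * l + c * c′ * l ≡
                 (d * d′ * l + d * d′ * l) + ((c - d) * (c′ + d′) * l + (c′ - d′) * (c + d) * l)
      polarize = solve-∀

    F+F′ : ∀ n i → i ≤ n → F n i + F′ n i ≡ signed i * 𝟙 (active? m n i)
    F+F′ n i i≤n = begin
      F n i + F′ n i
        ≡⟨ factor (signed i) (U j) (L i j) (L j i) ⟩
      signed i * (U j * (L i j + L j i))
        ≡⟨ cong (signed i *_) (𝟙-active m i j) ⟩
      signed i * 𝟙 (active? m (i ℕ.+ j) i)
        ≡⟨ cong (λ k → signed i * 𝟙 (active? m k i)) (ℕ.m+[n∸m]≡n i≤n) ⟩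
      signed i * 𝟙 (active? m n i)
        ∎
      where
      j = n ∸ i

      factor : ∀ s u x y → s * u * x + s * u * y ≡ s * (u * (x + y))
      factor = solve-∀

    ∑F+∑F′ : ∀ n → ∑ (suc n) (λ i → F n i + F′ n (n ∸ i)) ≡ H m signed n
    ∑F+∑F′ n = begin
      ∑ (suc n) (λ i → F n i + F′ n (n ∸ i))
        ≡⟨ ∑-distrib-+ (suc n) (F n) (λ i → F′ n (n ∸ i)) ⟩
      -- Reversing the second sum brings both roles of an element to the same index.
      ∑ (suc n) (F n) + ∑ (suc n) (λ i → F′ n (n ∸ i))
        ≡⟨ cong (λ x → ∑ (suc n) (F n) + x) (∑-reverse n (F′ n)) ⟩
      ∑ (suc n) (F n) + ∑ (suc n) (F′ n)
        ≡⟨ ∑-distrib-+ (suc n) (F n) (F′ n) ⟨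
      ∑ (suc n) (λ i → F n i + F′ n i)
        ≡⟨ ∑-cong (suc n) (λ i i<1+n → F+F′ n i (ℕ.s≤s⁻¹ i<1+n)) ⟩
      ∑ (suc n) (λ i → signed i * 𝟙 (active? m n i))
        -- Terms past n are inactive and terms past m have sign 0, so both ranges contain the
        -- support.
        ≡⟨ ∑-range (suc n) (suc m)
             (λ i n<i → *𝟙-no (signed i) (active? m n i) λ (i≤n , _) → ℕ.<⇒≱ n<i i≤n)
             (λ i m<i → cong (_* 𝟙 (active? m n i)) (signed-outside m<i)) ⟩
      H m signed n
        ∎

  2R-difference : ∀ n → + R C? n + + R C? n ≡ (+ R D? n + + R D? n) + H m signed n
  2R-difference n = begin
    + R C? n + + R C? n
      ≡⟨ cong₂ _+_ (R-as-∑ C? n) (R-as-∑ C? n) ⟩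
    ∑ (suc n) (pair C? n) + ∑ (suc n) (pair C? n)
      ≡⟨ ∑-distrib-+ (suc n) (pair C? n) (pair C? n) ⟨
    ∑ (suc n) (λ i → pair C? n i + pair C? n i)
      ≡⟨ ∑-cong (suc n) (λ i i<1+n → expand n i (ℕ.s≤s⁻¹ i<1+n)) ⟩
    ∑ (suc n) (λ i → (pair D? n i + pair D? n i) + (F n i + F′ n (n ∸ i)))
      ≡⟨ ∑-distrib-+ (suc n) (λ i → pair D? n i + pair D? n i) (λ i → F n i + F′ n (n ∸ i)) ⟩
    ∑ (suc n) (λ i → pair D? n i + pair D? n i) + ∑ (suc n) (λ i → F n i + F′ n (n ∸ i))
      ≡⟨ cong₂ _+_ (∑-distrib-+ (suc n) (pair D? n) (pair D? n)) (∑F+∑F′ n) ⟩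
    (∑ (suc n) (pair D? n) + ∑ (suc n) (pair D? n)) + H m signed n
      ≡⟨ cong (_+ H m signed n) (cong₂ _+_ (R-as-∑ D? n) (R-as-∑ D? n)) ⟨
    (+ R D? n + + R D? n) + H m signed n
      ∎

  R-equal⇒H≡0 : ∀ n → R C? n ≡ R D? n → H m signed n ≡ 0ℤ
  R-equal⇒H≡0 n eq = ∙-cancelˡ (+ R D? n + + R D? n) (H m signed n) 0ℤ (begin
    (+ R D? n + + R D? n) + H m signed n  ≡⟨ 2R-difference n ⟨
    + R C? n + + R C? n                   ≡⟨ cong (λ r → + r + + r) eq ⟩
    + R D? n + + R D? n                   ≡⟨ ℤ.+-identityʳ _ ⟨
    (+ R D? n + + R D? n) + 0ℤ            ∎)

  H≡0⇒R-equal : ∀ n → H m signed n ≡ 0ℤ → R C? n ≡ R D? n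
  H≡0⇒R-equal n H≡0 = double-injective (ℤ.+-injective (begin
    -- The sum of two nonnegative integers computes to this form, so the doubled counts can be
    -- compared in ℕ.
    + (R C? n ℕ.+ R C? n)                 ≡⟨ 2R-difference n ⟩
    (+ R D? n + + R D? n) + H m signed n  ≡⟨ cong (λ x → (+ R D? n + + R D? n) + x) H≡0 ⟩
    (+ R D? n + + R D? n) + 0ℤ            ≡⟨ ℤ.+-identityʳ _ ⟩
    + (R D? n ℕ.+ R D? n)                 ∎))

  -- The two directions of the equivalence

  -- Membership of 0 in C fixes the sign p(0) = 1, so p = t on [0,m]; symmetry then determines m.
  R-equal⇒initial-segment : 0 ∈ C → (∀ n → 0 < n → R C? n ≡ R D? n) →
                            ∃[ l ] (C ≐ Aₗ l × D ≐ Bₗ l)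
  R-equal⇒initial-segment 0∈C R-equal =
    l , ((λ x∈C → C⊆A x∈C , bound (inj₁ x∈C)) , λ (x∈A , _ , x≤) → A⊆C x∈A (subst (_ ≤_) (sym m≡2^l∸1) x≤)) ,
        ((λ x∈D → D⊆B x∈D , bound (inj₂ x∈D)) , λ (x∈B , _ , x≤) → B⊆D x∈B (subst (_ ≤_) (sym m≡2^l∸1) x≤))
    where
    H≡0 : ∀ n → 0 < n → H m signed n ≡ 0ℤ
    H≡0 n 0<n = R-equal⇒H≡0 n (R-equal n 0<n)

    power : ∃[ l ] m ≡ 2 ℕ.^ l ∸ 1
    power = Symmetric⇒2^l∸1 m (H≡0⇒Symmetric m signed (signed-C 0∈C) H≡0)

    l : ℕ
    l = proj₁ power

    m≡2^l∸1 : m ≡ 2 ℕ.^ l ∸ 1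
    m≡2^l∸1 = proj₂ power

    bound : ∀ {x} → x ∈ C ∪ D → x ∈ [ 0 , 2 ℕ.^ l ∸ 1 ]
    bound {x} x∈C∪D = z≤n , subst (x ≤_) m≡2^l∸1 (proj₂ (proj₁ cover x∈C∪D))

    t≡signed : ∀ {x} → x ∈ C ∪ D → t x ≡ signed x
    t≡signed {x} x∈C∪D = sym (H≡0⇒t m signed (signed-C 0∈C) H≡0 x (proj₂ (proj₁ cover x∈C∪D)))

    C⊆A : ∀ {x} → x ∈ C → x ∈ A
    C⊆A {x} x∈C = t≡1⇒A x (trans (t≡signed (inj₁ x∈C)) (signed-C x∈C))

    D⊆B : ∀ {x} → x ∈ D → x ∈ B
    D⊆B {x} x∈D = t≡-1⇒B x (trans (t≡signed (inj₂ x∈D)) (signed-D x∈D))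

    A⊆C : ∀ {x} → x ∈ A → x ≤ m → x ∈ C
    -- An element of [0,m] outside C would lie in D, hence in `B`.
    A⊆C x∈A x≤m = fromInj₁ (λ x∈D → contradiction x∈A (D⊆B x∈D)) (proj₂ cover (z≤n , x≤m))

    B⊆D : ∀ {x} → x ∈ B → x ≤ m → x ∈ D
    B⊆D x∈B x≤m = fromInj₂ (λ x∈C → contradiction (C⊆A x∈C) x∈B) (proj₂ cover (z≤n , x≤m))

  initial-segment⇒R-equal : ∃[ l ] (C ≐ Aₗ l × D ≐ Bₗ l) → ∀ n → R C? n ≡ R D? n
  initial-segment⇒R-equal (l , C≐A , D≐B) n = H≡0⇒R-equal n
    (trans (H-cong m n λ i i≤m → signed≡t (proj₂ cover (z≤n , i≤m)))
           (Symmetric⇒H-t≡0 m (subst Symmetric (sym m≡2^l∸1) (2^l∸1-Symmetric l)) n))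
    where
    signed≡t : ∀ {i} → i ∈ C ∪ D → signed i ≡ t i
    signed≡t {i} (inj₁ i∈C) = trans (signed-C i∈C) (sym (A⇒t≡1 i (proj₁ (proj₁ C≐A i∈C))))
    signed≡t {i} (inj₂ i∈D) = trans (signed-D i∈D) (sym (B⇒t≡-1 i (proj₁ (proj₁ D≐B i∈D))))

    bound : ∀ {x} → x ∈ C ∪ D → x ≤ 2 ℕ.^ l ∸ 1
    bound (inj₁ x∈C) = proj₂ (proj₂ (proj₁ C≐A x∈C))
    bound (inj₂ x∈D) = proj₂ (proj₂ (proj₁ D≐B x∈D))

    covered : ∀ {x} → (x ∈ A × t x ≡ 1ℤ) ⊎ (x ∈ B × t x ≡ -1ℤ) → x ≤ 2 ℕ.^ l ∸ 1 → x ∈ C ∪ D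
    covered (inj₁ (x∈A , _)) x≤ = inj₁ (proj₂ C≐A (x∈A , z≤n , x≤))
    covered (inj₂ (x∈B , _)) x≤ = inj₂ (proj₂ D≐B (x∈B , z≤n , x≤))

    -- Each bound is attained: m lies in C ∪ D, so m ≤ 2^l - 1; and 2^l - 1 lies in `A` or `B`,
    -- hence in C ∪ D, so it is at most m.
    m≡2^l∸1 : m ≡ 2 ℕ.^ l ∸ 1
    m≡2^l∸1 = ℕ.≤-antisym
      (bound (proj₂ cover (z≤n , ℕ.≤-refl)))
      (proj₂ (proj₁ cover (covered (t-values (2 ℕ.^ l ∸ 1)) ℕ.≤-refl)))

theorem3 : ∀ {c d} (m : ℕ) (C : Pred ℕ c) (D : Pred ℕ d)
    (cover : C ∪ D ≐ [ 0 , m ]) (disjoint : C ∩ D ≐ ∅) →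
    0 ∈ C →
    (∀ n → 0 < n → R (partˡ? [ 0 , m ]? C D cover disjoint) n ≡ R (partʳ? [ 0 , m ]? C D cover disjoint) n)
    ⇔ (∃[ l ] (C ≐ Aₗ l × D ≐ Bₗ l))
theorem3 m C D cover disjoint 0∈C = mk⇔
  (R-equal⇒initial-segment C? D? cover disjoint 0∈C)
  (λ initial n _ → initial-segment⇒R-equal C? D? cover disjoint initial n)
  where
  C? = partˡ? [ 0 , m ]? C D cover disjoint
  D? = partʳ? [ 0 , m ]? C D cover disjoint
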